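{- Let $\mathcal J$ be an ideal on $\omega$ which is a $P^+(\mathcal J)$-ideal and is $\le_{KB}$-homogeneous. (1) Assume CH. The following conditions are equivalent: (a) $\mathcal{ED}_{\mathrm{Fin}}\not\le_{KB}\mathcal J$; (b) there is a Q-point which is not a $\mathcal J$-point; (c) there is a Q-point which is not a weak $\mathcal J$-ultrafilter. (2) If $\mathcal J$ is $F_\sigma$, then CH can be relaxed to the assumption $\mathfrak p=\mathfrak c$ in (1).
   Context: An ideal on a set $X$ is a family of subsets of $X$ closed under finite unions and subsets, containing all finite subsets of $X$ and not containing $X$; $\mathcal J^+=\mathcal P(X)\setminus\mathcal J$. $F_\sigma$ refers to the topology of $\mathcal P(\omega)\cong\{0,1\}^\omega$. $\mathfrak c=2^{\aleph_0}$, and $\mathfrak p$ is the usual pseudointersection number. With $\Delta=\{(n,k)\in\omega^2:n\ge k\}$, $\mathcal{ED}_{\mathrm{Fin}}=\{A\subseteq\Delta:\exists m\ \forall n\ |\{k:(n,k)\in A\}|<m\}$, an ideal on $\Delta$. For ideals $\mathcal I$ on $X$ and $\mathcal K$ on $Y$, $\mathcal I\le_{KB}\mathcal K$ ($\mathcal I\le_P\mathcal K$) means that there is a finite-to-one (one-to-one, respectively) function $f:Y\to X$ with $f^{ -1}[B]\in\mathcal K$ for all $B\in\mathcal I$. $\mathcal J$ is a $P^+(\mathcal J)$-ideal if for each decreasing sequence $A_0\supseteq A_1\supseteq\dots$ of sets from $\mathcal J^+$ there is $B\in\mathcal J^+$ with $B\setminus A_n\in\mathcal J$ for all $n$. For $A\in\mathcal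 J^+$, $\mathcal J\restriction A=\{B\cap A:B\in\mathcal J\}$ (an ideal on $A$); $\mathcal J$ is $\le_{KB}$-homogeneous if $\mathcal J\restriction A\le_{KB}\mathcal J$ and $\mathcal J\le_{KB}\mathcal J\restriction A$ for every $A\in\mathcal J^+$. Ultrafilters on $\omega$ contain all cofinite sets; $\mathcal U^*=\{\omega\setminus A:A\in\mathcal U\}$. $\mathcal U$ is a weak $\mathcal J$-ultrafilter ($\mathcal J$-point) if $\mathcal J\not\le_{KB}\mathcal U^*$ ($\mathcal J\not\le_P\mathcal U^*$, respectively). $\mathcal U$ is a Q-point if for each partition $\{A_n:n\in\omega\}$ of $\omega$ into finite sets there is $A\in\mathcal U$ with $|A\cap A_n|=1$ for each $n$. -}

module Defs where

open import Data.Bool.Base using (Bool; true; false; T; not; _∧_; _∨_)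
open import Data.Fin.Base using (Fin)
import Data.Fin.Subset as Fin
open import Data.List.Base using (List; foldr)
open import Data.List.Membership.Propositional using () renaming (_∈_ to _∈ˡ_)
open import Data.List.Relation.Unary.All using (All)
open import Data.Nat.Base using (ℕ; suc; _<_)
import Data.Vec.Base as Vec
open import Data.Product.Base using (Σ; ∃; ∃-syntax; Σ-syntax; _×_; _,_; proj₁)
open import Data.Product using (∃!)
open import Data.Sum.Base using (_⊎_)
open import Function.Base using (_∘_)
open import Function.Bundles using (_↣_; _⤖_; _⇔_)
open import Function.Definitions using (Injective)
open import Level using (0ℓ)
open import Relation.Binary.PropositionalEquality using (_≡_; _≢_; _≗_)
open import Relation.Nullary.Negation using (¬_)
open import Relation.Unary using (Pred)

infix  4 _∈_ _⊆_ _≤KB_ _≤P_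
infixr 7 _∩_
infixr 6 _∪_
infixl 6 _∖_
infix  8 _⁺ _⋆
infix  7 _↾_

-- These notions are meant for classical mathematics, i.e. in the presence of
-- ExcludedMiddle and Extensionality.  Since Dec P is not truncated, excluded
-- middle selects an element of every nonempty type; extensionality makes this
-- selection depend only on the extension of a subset.  Together they therefore
-- give the axiom of choice.
--
-- Subsets are characteristic functions, so 𝒫 ℕ is the set {0,1}^ω itself.
-- Under function extensionality _≡_ on 𝒫 X is equality of subsets, and hence
-- _↣_ and _⤖_ between such types compare cardinalities correctly.
𝒫 : Set → Set
𝒫 X = X → Bool

_∈_ : {X : Set} → X → 𝒫 X → Set
x ∈ A = T (A x)

_⊆_ : {X : Set} → 𝒫 X → 𝒫 X → Set
A ⊆ B = ∀ x → x ∈ A → x ∈ B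

∅ full : {X : Set} → 𝒫 X
∅ _ = false
full _ = true

_∩_ _∪_ _∖_ : {X : Set} → 𝒫 X → 𝒫 X → 𝒫 X
(A ∩ B) x = A x ∧ B x
(A ∪ B) x = A x ∨ B x
(A ∖ B) x = A x ∧ not (B x)

∁ : {X : Set} → 𝒫 X → 𝒫 X
∁ A = full ∖ A

⋂ : {X : Set} → List (𝒫 X) → 𝒫 X
⋂ = foldr _∩_ full

-- A as a set in its own right; T is proof-irrelevant, so every element of A
-- occurs exactly once.
Elem : {X : Set} → 𝒫 X → Set
Elem A = ∃ (_∈ A)

Finite : {X : Set} → Pred X 0ℓ → Set
Finite P = ∃[ xs ] (∀ x → P x → x ∈ˡ xs)

Infinite : {X : Set} → Pred X 0ℓ → Set
Infinite P = ¬ Finite P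

Family : Set → Set₁
Family X = Pred (𝒫 X) 0ℓ

record IsIdeal {X : Set} (J : Family X) : Set where
  field
    ∪-closed : ∀ A B → J A → J B → J (A ∪ B)
    ⊆-closed : ∀ A B → A ⊆ B → J B → J A
    finite   : ∀ A → Finite (_∈ A) → J A
    proper   : ¬ J full

_⁺ : {X : Set} → Family X → Family X
(J ⁺) A = ¬ J A

_↾_ : {X : Set} → Family X → (A : 𝒫 X) → Family (Elem A)
(J ↾ A) C = ∃[ B ] (J B × C ≗ (B ∩ A) ∘ proj₁)

FiniteToOne : {X Y : Set} → (Y → X) → Set
FiniteToOne f = ∀ x → Finite (λ y → f y ≡ x)

-- B ∘ f is the preimage f⁻¹[B].
_≤KB_ _≤P_ : {X Y : Set} → Family X → Family Y → Set
I ≤KB K = ∃[ f ] (FiniteToOne f × ∀ B → I B → K (B ∘ f))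
I ≤P  K = ∃[ f ] (Injective _≡_ _≡_ f × ∀ B → I B → K (B ∘ f))

IsP⁺ : {X : Set} → Family X → Set
IsP⁺ {X} J =
  (A : ℕ → 𝒫 X) → (∀ n → (J ⁺) (A n)) → (∀ n → A (suc n) ⊆ A n) →
  ∃[ B ] ((J ⁺) B × ∀ n → J (B ∖ A n))

IsKBHomogeneous : {X : Set} → Family X → Set
IsKBHomogeneous J = ∀ A → (J ⁺) A → (J ↾ A ≤KB J) × (J ≤KB J ↾ A)

-- The pair (n , k) with k ≤ n, the bound being carried by k : Fin (suc n).
Δ : Set
Δ = Σ[ n ∈ ℕ ] Fin (suc n)

column : 𝒫 Δ → (n : ℕ) → Fin.Subset (suc n)
column A n = Vec.tabulate (λ k → A (n , k))

EDFin : Family Δ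
EDFin A = ∃[ m ] (∀ n → Fin.∣ column A n ∣ < m)

record IsUltrafilter (U : Family ℕ) : Set where
  field
    cofinite : ∀ A → Finite (_∈ ∁ A) → U A
    ∩-closed : ∀ A B → U A → U B → U (A ∩ B)
    ⊆-closed : ∀ A B → A ⊆ B → U A → U B
    proper   : ¬ U ∅
    ultra    : ∀ A → U A ⊎ U (∁ A)

_⋆ : Family ℕ → Family ℕ
(U ⋆) B = ∃[ A ] (U A × B ≗ ∁ A)

IsWeakUltrafilter IsPoint : {X : Set} → Family X → Family ℕ → Set
IsWeakUltrafilter J U = ¬ (J ≤KB U ⋆)
IsPoint           J U = ¬ (J ≤P  U ⋆)

record IsFinitePartition (A : ℕ → 𝒫 ℕ) : Set where
  field
    finite   : ∀ n → Finite (_∈ A n)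
    nonempty : ∀ n → ∃ (_∈ A n)
    disjoint : ∀ m n → m ≢ n → ∀ k → k ∈ A m → ¬ (k ∈ A n)
    cover    : ∀ k → ∃[ n ] (k ∈ A n)

record IsQPoint (U : Family ℕ) : Set where
  field
    isUltrafilter : IsUltrafilter U
    selector      : (A : ℕ → 𝒫 ℕ) → IsFinitePartition A →
                    ∃[ S ] (U S × ∀ n → ∃! _≡_ (_∈ (S ∩ A n)))

-- Product topology on {0,1}^ω: basic neighbourhoods fix finitely many
-- coordinates.
IsOpen IsClosed : Family ℕ → Set
IsOpen   C = ∀ A → C A → ∃[ n ] (∀ B → (∀ i → i < n → B i ≡ A i) → C B)
IsClosed C = IsOpen (λ A → ¬ C A)

IsFσ : Family ℕ → Set₁
IsFσ J = Σ[ C ∈ (ℕ → Family ℕ) ]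
  ((∀ n → IsClosed (C n)) × ∀ A → J A ⇔ (∃[ n ] C n A))

_≺_ : Set → Set → Set
X ≺ Y = (X ↣ Y) × ¬ (Y ↣ X)

CH : Set₁
CH = ¬ (Σ[ X ∈ Set ] (ℕ ≺ X × X ≺ 𝒫 ℕ))

SFIP : 𝒫 (𝒫 ℕ) → Set
SFIP S = ∀ Bs → All (_∈ S) Bs → Infinite (_∈ ⋂ Bs)

HasPseudointersection : 𝒫 (𝒫 ℕ) → Set
HasPseudointersection S =
  ∃[ A ] (Infinite (_∈ A) × ∀ B → B ∈ S → Finite (_∈ A ∖ B))

-- 𝔭 is the least cardinality of a family with SFIP and no pseudointersection;
-- cardinals are represented by types of that cardinality.
record IsPseudointersectionNumber (κ : Set) : Set where
  field
    attained : ∃[ S ] (SFIP S × ¬ HasPseudointersection S × (Elem S ⤖ κ))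
    least    : ∀ S → SFIP S → ¬ HasPseudointersection S → κ ↣ Elem S

𝔭≡𝔠 : Set
𝔭≡𝔠 = IsPseudointersectionNumber (𝒫 ℕ)

module _ (J : Family ℕ) where

  ConditionA : Set
  ConditionA = ¬ (EDFin ≤KB J)

  ConditionB ConditionC : Set₁
  ConditionB = ∃[ U ] (IsQPoint U × ¬ IsPoint J U)
  ConditionC = ∃[ U ] (IsQPoint U × ¬ IsWeakUltrafilter J U)

  ConditionsEquivalent : Set₁
  ConditionsEquivalent = (ConditionA ⇔ ConditionB) × (ConditionB ⇔ ConditionC)

{-# OPTIONS --safe #-}
module Submission where

-- For every finite-to-one map a Q-point U contains a set on which the map is
-- injective (QPoint⇒injectiveOn).  A finite-to-one reduction of J to the dual
-- of U can therefore be made one-to-one (QPoint-≤KB⇒≤P), and EDFin does not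
-- reduce to the dual of U, because a large set would be mapped to at most
-- one point in each column (QPoint⇒EDFin≰KB).  So an ideal that reduces to the dual of U
-- does not lie above EDFin.
--
-- Conversely, let EDFin not lie below J.  By homogeneity it does not lie below
-- the restriction of J to any positive set A.  This is what makes every
-- finite-to-one f injective on some positive subset of A: if all subsets of A on
-- which f is injective were null, then putting the fibres of f into different
-- columns of Δ would reduce EDFin to the restriction of J to A
-- (positive-selector).
--
-- The required Q-point is generated by a tower of positive sets, decreasing
-- modulo J, along a well-ordering of the continuum with initial segments of
-- smaller cardinality (smallWellOrder).  Each stage decides one subset of ℕ and
-- selects from one partition.  All stages being positive, the dual ideal of the
-- ultrafilter contains J, and the identity is a one-to-one reduction.
--
-- A stage can be added as soon as the earlier ones have a positive
-- pseudointersection modulo J (Extendible).  Under CH there are only countably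
-- many earlier stages, and J is a P⁺(J)-ideal (CH⇒extendible).  If J is the
-- union of closed sets C m, then by compactness a positive set contains, for
-- every n, a finite set that is included in no member of C 0, ..., C (n - 1).
-- As 𝔭 = 𝔠, there is a pseudointersection on the level of codes of such finite
-- sets; the union of the finite sets that it codes is a pseudointersection of
-- the earlier stages and belongs to no C m (Fσ⇒extendible).

open import Defs
open import Axiom.ExcludedMiddle using (ExcludedMiddle)
open import Axiom.Extensionality.Propositional using (Extensionality)
open import Data.Bool.Base using (Bool; true; false; T; not)
open import Data.Bool.Properties using (T-irrelevant)
open import Data.Empty using (⊥-elim)
open import Data.Fin.Base using (Fin; zero; suc; toℕ; fromℕ<)
open import Data.Fin.Properties using (toℕ-fromℕ<) renaming (suc-injective to Fin-suc-injective)
import Data.Fin.Subset as Fin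
open import Data.List.Base using (List; []; _∷_; [_]; _++_; map; concat; allFin)
open import Data.List.Extrema.Nat using (max; xs≤max)
open import Data.List.Membership.Propositional using () renaming (_∈_ to _∈ˡ_)
open import Data.List.Membership.Propositional.Properties
  using (∈-map⁺; ∈-concat⁺′; ∈-allFin; ∈-++⁺ˡ)
open import Data.List.Relation.Unary.All as All using (All; []; _∷_)
import Data.List.Relation.Unary.All.Properties as All
open import Data.List.Relation.Unary.Any using (here; there)
open import Data.Nat.Base using (ℕ; zero; suc; _⊔_; _≤_; _<_; z≤n; s≤s)
open import Data.Nat.Properties
  using (suc-injective; ≤-refl; ≤-trans; <⇒≤; m≤n⇒m≤1+n; n≮n; ≤-pred; m≤n⇒m<n∨m≡n; _≟_; <⇒≢; n≤0⇒n≡0;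
         m≤m⊔n; m≤n⊔m; m⊔n≤o⇒m≤o; m⊔n≤o⇒n≤o)
open import Data.Product.Base using (Σ; ∃; ∃-syntax; Σ-syntax; _×_; _,_; proj₁; proj₂)
open import Data.Product using (∃!)
open import Data.Sum.Base using (_⊎_; inj₁; inj₂; [_,_]′)
open import Data.Unit.Base using (tt)
open import Data.Vec.Base using ([]; _∷_; lookup; tabulate)
open import Data.Vec.Properties using (lookup∘tabulate; tabulate∘lookup)
open import Function.Base using (_∘_; id)
open import Function.Bundles using (_↣_; mk⇔; mk↣; module Injection; module Equivalence)
open import Function.Definitions using (Injective)
open import Induction.WellFounded using (WellFounded; Acc; acc; module All; module FixPoint)
open import Level using (Level; 0ℓ)
open import Relation.Binary.PropositionalEquality
  using (_≡_; _≢_; refl; sym; trans; cong; cong-app; subst)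
import Relation.Binary.Construct.On as On
open import Relation.Nullary.Decidable.Core using (yes; no; does; toSum)
open import Relation.Nullary.Negation using (¬_; contradiction)

private
  variable
    ℓ : Level
    X Y Z : Set

-- Coding finite sequences of natural numbers

double : ℕ → ℕ
double zero    = zero
double (suc n) = suc (suc (double n))

double-injective : Injective _≡_ _≡_ double
double-injective {zero}  {zero}  _ = refl
double-injective {suc m} {suc n} p =
  cong suc (double-injective (suc-injective (suc-injective p)))

double≢suc-double : ∀ m n → double m ≢ suc (double n)
double≢suc-double (suc m) (suc n) p =
  double≢suc-double m n (suc-injective (suc-injective p))

n≤double : ∀ n → n ≤ double n
n≤double zero    = z≤n
n≤double (suc n) = s≤s (m≤n⇒m≤1+n (n≤double n))

n<double : ∀ {n} → 0 < n → n < double n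
n<double {suc n} _ = s≤s (s≤s (n≤double n))

-- The number 2 ^ a * (2 * b + 1): never 0, and larger than a and b.
pair : ℕ → ℕ → ℕ
pair zero    b = suc (double b)
pair (suc a) b = double (pair a b)

pair-injective : ∀ a b a′ b′ → pair a b ≡ pair a′ b′ → a ≡ a′ × b ≡ b′
pair-injective zero    b zero     b′ p = refl , double-injective (suc-injective p)
pair-injective zero    b (suc a′) b′ p = ⊥-elim (double≢suc-double (pair a′ b′) b (sym p))
pair-injective (suc a) b zero     b′ p = ⊥-elim (double≢suc-double (pair a b) b′ p)
pair-injective (suc a) b (suc a′) b′ p
  with refl , q ← pair-injective a b a′ b′ (double-injective p) = refl , q

<pairˡ : ∀ a b → a < pair a b
<pairˡ zero    b = s≤s z≤n
<pairˡ (suc a) b = ≤-trans (s≤s (<pairˡ a b)) (n<double (≤-trans (s≤s z≤n) (<pairˡ a b)))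

<pairʳ : ∀ a b → b < pair a b
<pairʳ zero    b = s≤s (n≤double b)
<pairʳ (suc a) b = ≤-trans (<pairʳ a b) (n≤double (pair a b))

code : List ℕ → ℕ
code []       = 0
code (n ∷ ns) = pair n (code ns)

0≢code-∷ : ∀ n ns → 0 ≢ code (n ∷ ns)
0≢code-∷ n ns p = <⇒≢ (≤-trans (s≤s z≤n) (<pairˡ n (code ns))) p

code-injective : ∀ ms ns → code ms ≡ code ns → ms ≡ ns
code-injective []       []       _ = refl
code-injective []       (n ∷ ns) p = ⊥-elim (0≢code-∷ n ns p)
code-injective (m ∷ ms) []       p = ⊥-elim (0≢code-∷ m ms (sym p))
code-injective (m ∷ ms) (n ∷ ns) p
  with refl , q ← pair-injective m (code ms) n (code ns) p = cong (m ∷_) (code-injective ms ns q)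

-- Subsets and finite-to-one maps

not⁺ : ∀ b → ¬ T b → T (not b)
not⁺ false _ = tt
not⁺ true  p = p tt

not⁻ : ∀ b → T (not b) → ¬ T b
not⁻ false _ ()

∩⁺ : ∀ (A B : 𝒫 X) {x} → x ∈ A → x ∈ B → x ∈ A ∩ B
∩⁺ A B {x} p q with A x
... | true = q

∩⁻ : ∀ (A B : 𝒫 X) {x} → x ∈ A ∩ B → x ∈ A × x ∈ B
∩⁻ A B {x} p with A x
... | true = tt , p

∪⁺ : ∀ (A B : 𝒫 X) {x} → x ∈ A ⊎ x ∈ B → x ∈ A ∪ B
∪⁺ A B {x} p with A x | p
... | true  | _      = tt
... | false | inj₂ q = q

∖⁺ : ∀ (A B : 𝒫 X) {x} → x ∈ A → ¬ (x ∈ B) → x ∈ A ∖ B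
∖⁺ A B {x} p q = ∩⁺ A (not ∘ B) p (not⁺ (B x) q)

∖⁻ : ∀ (A B : 𝒫 X) {x} → x ∈ A ∖ B → x ∈ A × ¬ (x ∈ B)
∖⁻ A B {x} p with p₁ , p₂ ← ∩⁻ A (not ∘ B) p = p₁ , not⁻ (B x) p₂

⋂⁻ : ∀ (Bs : List (𝒫 X)) {B x} → x ∈ ⋂ Bs → B ∈ˡ Bs → x ∈ B
⋂⁻ (B ∷ Bs) p (here refl) = proj₁ (∩⁻ B (⋂ Bs) p)
⋂⁻ (B ∷ Bs) p (there q)   = ⋂⁻ Bs (proj₂ (∩⁻ B (⋂ Bs) p)) q

bool-≡ : ∀ {a b} → (T a → T b) → (T b → T a) → a ≡ b
bool-≡ {false} {false} f g = refl
bool-≡ {false} {true}  f g = ⊥-elim (g tt)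
bool-≡ {true}  {false} f g = ⊥-elim (f tt)
bool-≡ {true}  {true}  f g = refl

Elem-≡ : ∀ {A : 𝒫 X} {x y : Elem A} → proj₁ x ≡ proj₁ y → x ≡ y
Elem-≡ {x = x , p} {y = x , q} refl = cong (x ,_) (T-irrelevant p q)

InjectiveOn : {X Y : Set} → (X → Y) → 𝒫 X → Set
InjectiveOn f A = ∀ x y → x ∈ A → y ∈ A → f x ≡ f y → x ≡ y

∘-finiteToOne : {f : Y → X} {g : Z → Y} → FiniteToOne f → FiniteToOne g → FiniteToOne (f ∘ g)
∘-finiteToOne {f = f} {g} f-fin g-fin x =
  concat (map (proj₁ ∘ g-fin) (proj₁ (f-fin x))) ,
  λ z fgz≡x → ∈-concat⁺′ (proj₂ (g-fin (g z)) z refl)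
                          (∈-map⁺ (proj₁ ∘ g-fin) (proj₂ (f-fin x) (g z) fgz≡x))

≤KB-trans : ∀ {I : Family X} {J : Family Y} {K : Family Z} → I ≤KB J → J ≤KB K → I ≤KB K
≤KB-trans (f , f-fin , f-pre) (g , g-fin , g-pre) =
  f ∘ g , ∘-finiteToOne f-fin g-fin , λ B IB → g-pre (B ∘ f) (f-pre B IB)

proj₁-finiteToOne : FiniteToOne {ℕ} {Δ} proj₁
proj₁-finiteToOne n =
  map (n ,_) (allFin (suc n)) , λ { (n , k) refl → ∈-map⁺ (n ,_) (∈-allFin k) }

unbounded⇒infinite : {P : ℕ → Set} → (∀ n → ∃[ k ] (n < k × P k)) → Infinite P
unbounded⇒infinite unb (ks , all) with k , m<k , Pk ← unb (max 0 ks) =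
  n≮n _ (≤-trans m<k (All.lookup (xs≤max 0 ks) (all k Pk)))

-- Columns of subsets of Δ

∣∣≡0⁺ : ∀ {n} (v : Fin.Subset n) → (∀ i → ¬ T (lookup v i)) → Fin.∣ v ∣ ≡ 0
∣∣≡0⁺ []          _ = refl
∣∣≡0⁺ (true  ∷ v) p = ⊥-elim (p zero tt)
∣∣≡0⁺ (false ∷ v) p = ∣∣≡0⁺ v (p ∘ suc)

∣∣≡0⁻ : ∀ {n} (v : Fin.Subset n) → Fin.∣ v ∣ ≡ 0 → ∀ i → ¬ T (lookup v i)
∣∣≡0⁻ (false ∷ v) p (suc i) = ∣∣≡0⁻ v p i

∣∣≤1 : ∀ {n} (v : Fin.Subset n) →
  (∀ i j → T (lookup v i) → T (lookup v j) → i ≡ j) → Fin.∣ v ∣ ≤ 1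
∣∣≤1 []          _ = z≤n
∣∣≤1 (false ∷ v) u = ∣∣≤1 v λ i j p q → Fin-suc-injective (u (suc i) (suc j) p q)
∣∣≤1 (true  ∷ v) u
  rewrite ∣∣≡0⁺ v (λ i p → contradiction (u zero (suc i) tt p) λ ()) = s≤s z≤n

-- Repeated m times on a set with at most m elements, this splits the set into
-- singletons.
dropFirst : ∀ {n} → Fin.Subset n → Fin.Subset n
dropFirst []          = []
dropFirst (true  ∷ v) = false ∷ v
dropFirst (false ∷ v) = false ∷ dropFirst v

∣dropFirst∣ : ∀ {n} (v : Fin.Subset n) {m} → Fin.∣ v ∣ ≤ suc m → Fin.∣ dropFirst v ∣ ≤ m
∣dropFirst∣ []          _       = z≤n
∣dropFirst∣ (true  ∷ v) (s≤s p) = p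
∣dropFirst∣ (false ∷ v) p       = ∣dropFirst∣ v p

dropped-unique : ∀ {n} (v : Fin.Subset n) i j →
  T (lookup v i) → ¬ T (lookup (dropFirst v) i) →
  T (lookup v j) → ¬ T (lookup (dropFirst v) j) → i ≡ j
dropped-unique (true  ∷ v) zero    zero    _ _ _ _ = refl
dropped-unique (true  ∷ v) (suc i) _       p q _ _ = ⊥-elim (q p)
dropped-unique (true  ∷ v) zero    (suc j) _ _ p q = ⊥-elim (q p)
dropped-unique (false ∷ v) (suc i) (suc j) p q r s = cong suc (dropped-unique v i j p q r s)

module _ (em : ∀ {ℓ} → ExcludedMiddle ℓ) (ext : ∀ {a b} → Extensionality a b) where

  -- Comprehension, selectors and ultrafilters

  opaque
    byContradiction : {P : Set ℓ} → ¬ ¬ P → P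
    byContradiction {P = P} ¬¬p with em {P = P}
    ... | yes p = p
    ... | no ¬p = ⊥-elim (¬¬p ¬p)

  opaque
    -- Predicates of any level are resized to characteristic functions.
    ⟦_⟧ : (X → Set ℓ) → 𝒫 X
    ⟦ P ⟧ x = does (em {P = P x})

    ⟦⟧⁺ : {P : X → Set ℓ} {x : X} → P x → x ∈ ⟦ P ⟧
    ⟦⟧⁺ {P = P} {x} p with em {P = P x}
    ... | yes _ = tt
    ... | no ¬p = ¬p p

    ⟦⟧⁻ : {P : X → Set ℓ} {x : X} → x ∈ ⟦ P ⟧ → P x
    ⟦⟧⁻ {P = P} {x} t with em {P = P x}
    ... | yes p = p

  ∈? : ∀ (A : 𝒫 X) x → x ∈ A ⊎ ¬ (x ∈ A)
  ∈? A x with A x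
  ... | true  = inj₁ tt
  ... | false = inj₂ λ ()

  𝒫-≡ : ∀ {A B : 𝒫 X} → A ⊆ B → B ⊆ A → A ≡ B
  𝒫-≡ p q = ext λ x → bool-≡ (p x) (q x)

  injective⇒finiteToOne : {f : Y → X} → Injective _≡_ _≡_ f → FiniteToOne f
  injective⇒finiteToOne {f = f} f-inj x with em {P = ∃[ y ] (f y ≡ x)}
  ... | yes (y , fy≡x) = [ y ] , λ z fz≡x → here (f-inj (trans fz≡x (sym fy≡x)))
  ... | no  ¬y         = []    , λ z fz≡x → ⊥-elim (¬y (z , fz≡x))

  ≤P⇒≤KB : ∀ {I : Family X} {K : Family Y} → I ≤P K → I ≤KB K
  ≤P⇒≤KB (f , f-inj , f-pre) = f , injective⇒finiteToOne f-inj , f-pre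

  module Ultrafilter {U : Family ℕ} (ultrafilter : IsUltrafilter U) where
    open IsUltrafilter ultrafilter public

    dual⁻ : ∀ {B} → (U ⋆) B → U (∁ B)
    dual⁻ {B} (A , UA , B≗∁A) =
      ⊆-closed A (∁ B) (λ x x∈A → not⁺ (B x) λ x∈B → not⁻ (A x) (subst T (B≗∁A x) x∈B) x∈A) UA

    dual⁺ : ∀ {B} → U (∁ B) → (U ⋆) B
    dual⁺ {B} U∁B = ∁ B , U∁B , λ x → bool-≡
      (λ x∈B → not⁺ (not (B x)) λ x∉B → not⁻ (B x) x∉B x∈B)
      (λ x∈∁∁B → [ id , (λ x∉B → ⊥-elim (not⁻ (not (B x)) x∈∁∁B (not⁺ (B x) x∉B))) ]′ (∈? B x))

    meet : ∀ {A B} → U A → U B → ∃[ C ] (U C × C ⊆ A × C ⊆ B)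
    meet {A} {B} UA UB = A ∩ B , ∩-closed A B UA UB ,
      (λ x → proj₁ ∘ ∩⁻ A B) , (λ x → proj₂ ∘ ∩⁻ A B)

    -- The even or the odd numbers serve as the range of e.
    avoid-range : (f : ℕ → ℕ) →
      ∃[ e ] (Injective _≡_ _≡_ e × U ⟦ (λ x → ∀ y → f x ≢ e y) ⟧)
    avoid-range f with ultra ⟦ (λ x → ∃[ y ] (f x ≡ double y)) ⟧
    ... | inj₁ U-even = suc ∘ double , double-injective ∘ suc-injective ,
          ⊆-closed _ _ (λ x p → ⟦⟧⁺ (avoid (⟦⟧⁻ p))) U-even
      where
      avoid : ∀ {x} → ∃[ y ] (f x ≡ double y) → ∀ y → f x ≢ suc (double y)
      avoid (y , p) z q = double≢suc-double y z (trans (sym p) q)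
    ... | inj₂ U-odd = double , double-injective ,
          ⊆-closed _ _ (λ x p → ⟦⟧⁺ λ y q → not⁻ _ p (⟦⟧⁺ (y , q))) U-odd

  -- The fibres of f need not be nonempty.  They become so when f is redefined,
  -- off a set of the ultrafilter, as a map onto ℕ.
  QPoint⇒injectiveOn : ∀ {U} → IsQPoint U → (f : ℕ → ℕ) → FiniteToOne f →
    ∃[ S ] (U S × InjectiveOn f S)
  QPoint⇒injectiveOn {U} qpoint f f-fin
    with e , e-inj , UA ← Ultrafilter.avoid-range (IsQPoint.isUltrafilter qpoint) id
    = result
    where
    open Ultrafilter (IsQPoint.isUltrafilter qpoint)
    A = ⟦ (λ x → ∀ y → x ≢ e y) ⟧

    g : ℕ → ℕ
    g x with em {P = ∃[ y ] (x ≡ e y)}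
    ... | yes (y , _) = y
    ... | no  _       = f x

    g-e : ∀ y → g (e y) ≡ y
    g-e y with em {P = ∃[ z ] (e y ≡ e z)}
    ... | yes (z , p) = sym (e-inj p)
    ... | no  ¬z      = ⊥-elim (¬z (y , refl))

    g-A : ∀ {x} → x ∈ A → g x ≡ f x
    g-A {x} x∈A with em {P = ∃[ y ] (x ≡ e y)}
    ... | yes (y , p) = ⊥-elim (⟦⟧⁻ x∈A y p)
    ... | no  _       = refl

    g-fin : ∀ n x → g x ≡ n → x ∈ˡ e n ∷ proj₁ (f-fin n)
    g-fin n x p with em {P = ∃[ y ] (x ≡ e y)}
    ... | yes (y , q) = here (trans q (cong e p))
    ... | no  _       = there (proj₂ (f-fin n) x p)

    fibre : ℕ → 𝒫 ℕ
    fibre n = ⟦ (λ x → g x ≡ n) ⟧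

    partition : IsFinitePartition fibre
    partition = record
      { finite   = λ n → e n ∷ proj₁ (f-fin n) , λ x p → g-fin n x (⟦⟧⁻ p)
      ; nonempty = λ n → e n , ⟦⟧⁺ (g-e n)
      ; disjoint = λ m n m≢n k p q → m≢n (trans (sym (⟦⟧⁻ p)) (⟦⟧⁻ q))
      ; cover    = λ k → g k , ⟦⟧⁺ refl
      }

    result : ∃[ S ] (U S × InjectiveOn f S)
    result with S , US , once ← IsQPoint.selector qpoint fibre partition
           with C , UC , C⊆S , C⊆A ← meet US UA
      = C , UC , λ x y x∈C y∈C fx≡fy →
          let z , _ , unique = once (g x)
              gy≡gx = trans (g-A (C⊆A y y∈C)) (trans (sym fx≡fy) (sym (g-A (C⊆A x x∈C))))
          in trans (sym (unique (∩⁺ S (fibre (g x)) (C⊆S x x∈C) (⟦⟧⁺ refl))))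
                   (unique (∩⁺ S (fibre (g x)) (C⊆S y y∈C) (⟦⟧⁺ gy≡gx)))

  -- From finite-to-one to one-to-one maps: f is kept on a set of U on which it
  -- is injective, and the remaining points are sent to values avoided there.
  QPoint-≤KB⇒≤P : ∀ {U} {J : Family ℕ} → IsQPoint U → J ≤KB U ⋆ → J ≤P U ⋆
  QPoint-≤KB⇒≤P {U} {J} qpoint (f , f-fin , f-pre)
    with S , US , f-inj ← QPoint⇒injectiveOn qpoint f f-fin
       | e , e-inj , UA ← Ultrafilter.avoid-range (IsQPoint.isUltrafilter qpoint) f
    with C , UC , C⊆S , C⊆A ← Ultrafilter.meet (IsQPoint.isUltrafilter qpoint) US UA
    = g , g-inj , λ B JB → dual⁺
        (⊆-closed _ _ (λ x p → subst (λ n → T (not (B n))) (sym (g-C (proj₁ (∩⁻ C (∁ (B ∘ f)) p))))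
                               (proj₂ (∩⁻ C (∁ (B ∘ f)) p)))
                  (∩-closed C (∁ (B ∘ f)) UC (dual⁻ (f-pre B JB))))
    where
    open Ultrafilter (IsQPoint.isUltrafilter qpoint)

    g : ℕ → ℕ
    g x = [ (λ _ → f x) , (λ _ → e x) ]′ (∈? C x)

    g-C : ∀ {x} → x ∈ C → g x ≡ f x
    g-C {x} p with ∈? C x
    ... | inj₁ _ = refl
    ... | inj₂ q = ⊥-elim (q p)

    g-inj : Injective _≡_ _≡_ g
    g-inj {x} {y} p with ∈? C x | ∈? C y
    ... | inj₁ q | inj₁ r = f-inj x y (C⊆S x q) (C⊆S y r) p
    ... | inj₁ q | inj₂ r = ⊥-elim (⟦⟧⁻ (C⊆A x q) y p)
    ... | inj₂ q | inj₁ r = ⊥-elim (⟦⟧⁻ (C⊆A y r) x (sym p))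
    ... | inj₂ q | inj₂ r = e-inj p

  -- A Q-point contains a set that h maps injectively into distinct columns, so
  -- its image lies in the ideal although its preimage is large.
  QPoint⇒EDFin≰KB : ∀ {U} → IsQPoint U → ¬ (EDFin ≤KB U ⋆)
  QPoint⇒EDFin≰KB {U} qpoint (h , h-fin , h-pre)
    with S , US , col-inj ← QPoint⇒injectiveOn qpoint (proj₁ ∘ h) (∘-finiteToOne proj₁-finiteToOne h-fin)
    = proper (⊆-closed _ ∅ (λ x p → not⁻ _ (proj₂ (∩⁻ S (∁ (D ∘ h)) p))
                                     (⟦⟧⁺ (x , proj₁ (∩⁻ S (∁ (D ∘ h)) p) , refl)))
                       (∩-closed S (∁ (D ∘ h)) US (dual⁻ (h-pre D D∈EDFin))))
    where
    open Ultrafilter (IsQPoint.isUltrafilter qpoint)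

    D : 𝒫 Δ
    D = ⟦ (λ d → ∃[ s ] (s ∈ S × h s ≡ d)) ⟧

    one : ∀ {n} {i j : Fin (suc n)} → (n , i) ∈ D → (n , j) ∈ D → i ≡ j
    one {n} {i} {j} p q with ⟦⟧⁻ p | ⟦⟧⁻ q
    ... | s , s∈S , hs | t , t∈S , ht
      with refl ← col-inj s t s∈S t∈S (trans (cong proj₁ hs) (sym (cong proj₁ ht)))
      with refl ← trans (sym hs) ht = refl

    D∈EDFin : EDFin D
    D∈EDFin = 2 , λ n → s≤s (∣∣≤1 (column D n) λ i j p q →
      one (subst T (lookup∘tabulate (λ k → D (n , k)) i) p)
          (subst T (lookup∘tabulate (λ k → D (n , k)) j) q))

  -- Selectors inside positive sets

  module Ideal {J : Family ℕ} (ideal : IsIdeal J) where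
    open IsIdeal ideal

    null-⊆ : ∀ {A B} → J B → A ⊆ B → J A
    null-⊆ {A} {B} JB A⊆B = ⊆-closed A B A⊆B JB

    null-cover : ∀ {A B C} → J B → J C → (∀ x → x ∈ A → x ∈ B ⊎ x ∈ C) → J A
    null-cover {B = B} {C} JB JC cover =
      null-⊆ (∪-closed B C JB JC) λ x x∈A → ∪⁺ B C (cover x x∈A)

    null-∅ : ∀ {A} → (∀ x → ¬ (x ∈ A)) → J A
    null-∅ {A} empty = finite A ([] , λ x x∈A → ⊥-elim (empty x x∈A))

    infix 4 _⊆ᴶ_

    -- Inclusion modulo J, as a record so that A and B are determined by the type
    -- of a proof.
    record _⊆ᴶ_ (A B : 𝒫 ℕ) : Set where
      constructor almost
      field remainder : J (A ∖ B)

    open _⊆ᴶ_ public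

    ⊆⇒⊆ᴶ : ∀ {A B} → A ⊆ B → A ⊆ᴶ B
    ⊆⇒⊆ᴶ {A} {B} A⊆B =
      almost (null-∅ λ x p → proj₂ (∖⁻ A B p) (A⊆B x (proj₁ (∖⁻ A B p))))

    ⊆ᴶ-refl : ∀ {A} → A ⊆ᴶ A
    ⊆ᴶ-refl = ⊆⇒⊆ᴶ λ _ p → p

    ⊆ᴶ-trans : ∀ {A B C} → A ⊆ᴶ B → B ⊆ᴶ C → A ⊆ᴶ C
    ⊆ᴶ-trans {A} {B} {C} AB BC = almost (null-cover (remainder AB) (remainder BC) λ x p →
      [ (λ x∈B → inj₂ (∖⁺ B C x∈B (proj₂ (∖⁻ A C p))))
      , (λ x∉B → inj₁ (∖⁺ A B (proj₁ (∖⁻ A C p)) x∉B)) ]′ (∈? B x))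

    ⊆ᴶ-∩ : ∀ {A B C} → A ⊆ᴶ B → A ⊆ᴶ C → A ⊆ᴶ B ∩ C
    ⊆ᴶ-∩ {A} {B} {C} AB AC = almost (null-cover (remainder AB) (remainder AC) λ x p →
      [ (λ x∈B → inj₂ (∖⁺ A C (proj₁ (∖⁻ A (B ∩ C) p))
                               λ x∈C → proj₂ (∖⁻ A (B ∩ C) p) (∩⁺ B C x∈B x∈C)))
      , (λ x∉B → inj₁ (∖⁺ A B (proj₁ (∖⁻ A (B ∩ C) p)) x∉B)) ]′ (∈? B x))

    positive-⊆ᴶ : ∀ {A B} → (J ⁺) A → A ⊆ᴶ B → (J ⁺) B
    positive-⊆ᴶ {A} {B} A⁺ AB JB = A⁺ (null-cover (remainder AB) JB λ x x∈A →
      [ inj₂ , (λ x∉B → inj₁ (∖⁺ A B x∈A x∉B)) ]′ (∈? B x))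

    -- Fibres of f become columns of Δ, and x has height x in its column.  A set
    -- with at most m points in each column is pulled back to a union of m sets
    -- on which f is injective.
    null-selectors⇒EDFin≤KB : (f : ℕ → ℕ) → FiniteToOne f → ∀ A →
      (∀ B → B ⊆ A → InjectiveOn f B → J B) → EDFin ≤KB J ↾ A
    null-selectors⇒EDFin≤KB f f-fin A null =
      place ∘ proj₁ , injective⇒finiteToOne (Elem-≡ ∘ place-inj) , λ { D (m , bound) →
        pull D , bounded m D (<⇒≤ ∘ bound) , λ { (x , x∈A) → bool-≡
          (λ p → ∩⁺ (pull D) A (⟦⟧⁺ (x∈A , p)) x∈A)
          (λ p → proj₂ (⟦⟧⁻ (proj₁ (∩⁻ (pull D) A p)))) } }
      where
      -- The maximum leaves room for the whole fibre; pairing with n keeps the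
      -- columns of different fibres apart.
      col : ℕ → ℕ
      col n = pair n (max 0 (proj₁ (f-fin n)))

      x≤col : ∀ x → x < suc (col (f x))
      x≤col x = s≤s (≤-trans (All.lookup (xs≤max 0 _) (proj₂ (f-fin (f x)) x refl))
                             (<⇒≤ (<pairʳ (f x) _)))

      place : ℕ → Δ
      place x = col (f x) , fromℕ< (x≤col x)

      place-inj : ∀ {x y} → place x ≡ place y → x ≡ y
      place-inj {x} {y} p =
        trans (sym (toℕ-fromℕ< (x≤col x))) (trans (cong (λ d → toℕ (proj₂ d)) p) (toℕ-fromℕ< (x≤col y)))

      pull : 𝒫 Δ → 𝒫 ℕ
      pull D = ⟦ (λ x → x ∈ A × place x ∈ D) ⟧

      column⁺ : ∀ (D : 𝒫 Δ) {n k} → (n , k) ∈ D → T (lookup (column D n) k)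
      column⁺ D {n} {k} p = subst T (sym (lookup∘tabulate (λ k → D (n , k)) k)) p

      shave : 𝒫 Δ → 𝒫 Δ
      shave D (n , k) = lookup (dropFirst (column D n)) k

      column-shave : ∀ D n → column (shave D) n ≡ dropFirst (column D n)
      column-shave D n = tabulate∘lookup (dropFirst (column D n))

      shaved-unique : ∀ D {d e} → proj₁ d ≡ proj₁ e →
        d ∈ D → ¬ (d ∈ shave D) → e ∈ D → ¬ (e ∈ shave D) → d ≡ e
      shaved-unique D {n , i} {n , j} refl p q r s =
        cong (n ,_) (dropped-unique (column D n) i j (column⁺ D p) q (column⁺ D r) s)

      bounded : ∀ m D → (∀ n → Fin.∣ column D n ∣ ≤ m) → J (pull D)
      bounded zero D bound = null-∅ λ x p →
        ∣∣≡0⁻ (column D (col (f x))) (n≤0⇒n≡0 (bound (col (f x)))) (fromℕ< (x≤col x))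
              (column⁺ D (proj₂ (⟦⟧⁻ p)))
      bounded (suc m) D bound = null-cover
        (bounded m (shave D) λ n → subst (λ v → Fin.∣ v ∣ ≤ m) (sym (column-shave D n))
                                         (∣dropFirst∣ (column D n) (bound n)))
        (null ⟦ (λ x → (x ∈ A × place x ∈ D) × ¬ (place x ∈ shave D)) ⟧
              (λ x p → proj₁ (proj₁ (⟦⟧⁻ p)))
              (λ x y p q fx≡fy → place-inj (shaved-unique D (cong col fx≡fy)
                (proj₂ (proj₁ (⟦⟧⁻ p))) (proj₂ (⟦⟧⁻ p)) (proj₂ (proj₁ (⟦⟧⁻ q))) (proj₂ (⟦⟧⁻ q)))))
        split
        where
        split : ∀ x → x ∈ pull D → x ∈ pull (shave D) ⊎
          x ∈ ⟦ (λ x → (x ∈ A × place x ∈ D) × ¬ (place x ∈ shave D)) ⟧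
        split x p = let x∈A , x∈D = ⟦⟧⁻ p in
          [ (λ q → inj₁ (⟦⟧⁺ (x∈A , q))) , (λ q → inj₂ (⟦⟧⁺ ((x∈A , x∈D) , q))) ]′
            (∈? (shave D) (place x))

    positive-selector : IsKBHomogeneous J → ¬ (EDFin ≤KB J) →
      (f : ℕ → ℕ) → FiniteToOne f → ∀ A → (J ⁺) A →
      ∃[ B ] (B ⊆ A × (J ⁺) B × InjectiveOn f B)
    positive-selector hom EDFin≰J f f-fin A A⁺ = byContradiction λ none →
      EDFin≰J (≤KB-trans {J = J ↾ A} {K = J}
        (null-selectors⇒EDFin≤KB f f-fin A λ B B⊆A f-inj → byContradiction λ B⁺ →
          none (B , B⊆A , B⁺ , f-inj))
        (proj₁ (hom A A⁺)))

    positive-decides : ∀ A → (J ⁺) A → ∀ C →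
      ∃[ B ] (B ⊆ A × (J ⁺) B × (B ⊆ C ⊎ B ⊆ ∁ C))
    positive-decides A A⁺ C with em {P = J (A ∩ C)}
    ... | no  A∩C⁺ = A ∩ C , (λ x → proj₁ ∘ ∩⁻ A C) , A∩C⁺ , inj₁ (λ x → proj₂ ∘ ∩⁻ A C)
    ... | yes JA∩C = A ∖ C , (λ x → proj₁ ∘ ∖⁻ A C) ,
          (λ JA∖C → A⁺ (null-cover JA∩C JA∖C λ x x∈A →
            [ inj₁ ∘ ∩⁺ A C x∈A , inj₂ ∘ ∖⁺ A C x∈A ]′ (∈? C x))) ,
          inj₂ (λ x → proj₂ ∘ ∩⁻ A (∁ C))

    Selects : 𝒫 ℕ → (ℕ → 𝒫 ℕ) → Set
    Selects B P = IsFinitePartition P → ∀ n k l → k ∈ B → l ∈ B → k ∈ P n → l ∈ P n → k ≡ l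

    part-of : ∀ {P} → IsFinitePartition P →
      Σ[ f ∈ (ℕ → ℕ) ] (FiniteToOne f × ∀ k n → k ∈ P n → f k ≡ n)
    part-of {P} part = proj₁ ∘ cover ,
      (λ n → proj₁ (P-finite n) , λ k fk≡n →
        proj₂ (P-finite n) k (subst (λ m → k ∈ P m) fk≡n (proj₂ (cover k)))) ,
      λ k n k∈Pn → byContradiction λ q → disjoint _ n q k (proj₂ (cover k)) k∈Pn
      where open IsFinitePartition part renaming (finite to P-finite)

    positive-refine : IsKBHomogeneous J → ¬ (EDFin ≤KB J) → ∀ A → (J ⁺) A → ∀ C P →
      ∃[ B ] (B ⊆ A × (J ⁺) B × (B ⊆ C ⊎ B ⊆ ∁ C) × Selects B P)
    positive-refine hom EDFin≰J A A⁺ C P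
      with B , B⊆A , B⁺ , B-dec ← positive-decides A A⁺ C
      with em {P = IsFinitePartition P}
    ... | no  ¬part = B , B⊆A , B⁺ , B-dec , λ part → ⊥-elim (¬part part)
    ... | yes part =
      let f , f-fin , f≡ = part-of part
          S , S⊆B , S⁺ , f-inj = positive-selector hom EDFin≰J f f-fin B B⁺
      in S , (λ x → B⊆A x ∘ S⊆B x) , S⁺ ,
        [ (λ B⊆C → inj₁ λ x → B⊆C x ∘ S⊆B x) , (λ B⊆∁C → inj₂ λ x → B⊆∁C x ∘ S⊆B x) ]′ B-dec ,
        λ _ n k l k∈S l∈S k∈Pn l∈Pn → f-inj k l k∈S l∈S (trans (f≡ k n k∈Pn) (sym (f≡ l n l∈Pn)))

  -- Sets of size less than the continuum

  decode : 𝒫 ℕ → ℕ → 𝒫 ℕ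
  decode A n k = A (pair n k)

  encode : (ℕ → 𝒫 ℕ) → 𝒫 ℕ
  encode 𝒜 = ⟦ (λ c → ∃[ n ] ∃[ k ] (pair n k ≡ c × k ∈ 𝒜 n)) ⟧

  decode-encode : ∀ 𝒜 n → decode (encode 𝒜) n ≡ 𝒜 n
  decode-encode 𝒜 n = 𝒫-≡ to λ k k∈𝒜n → ⟦⟧⁺ (n , k , refl , k∈𝒜n)
    where
    to : decode (encode 𝒜) n ⊆ 𝒜 n
    to k p with n′ , k′ , eq , k′∈𝒜n′ ← ⟦⟧⁻ {x = pair n k} p
      with refl , refl ← pair-injective n′ k′ n k eq = k′∈𝒜n′

  couple : 𝒫 ℕ → 𝒫 ℕ → 𝒫 ℕ
  couple A B = encode λ { zero → A ; (suc _) → B }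

  couple-injective : ∀ A B A′ B′ → couple A B ≡ couple A′ B′ → A ≡ A′ × B ≡ B′
  couple-injective A B A′ B′ p = component 0 , component 1
    where
    component : ∀ n → _
    component n = trans (sym (decode-encode _ n))
      (trans (cong (λ C → decode C n) p) (decode-encode _ n))

  cantor : ¬ (𝒫 ℕ ↣ ℕ)
  cantor ι = D∉ (⟦⟧⁺ (D , refl , D∉))
    where
    open Injection ι
    D : 𝒫 ℕ
    D = ⟦ (λ n → ∃[ A ] (to A ≡ n × ¬ (n ∈ A))) ⟧
    D∉ : ¬ (to D ∈ D)
    D∉ p with ⟦⟧⁻ p
    ... | A , q , r = r (subst (to D ∈_) (sym (injective q)) p)

  -- Either some row of 𝒫 ℕ × 𝒫 ℕ is sent into X entirely, or every row has an
  -- element sent into ℕ, against Cantor's theorem.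
  ⊎ℕ-small : X ≺ 𝒫 ℕ → (X ⊎ ℕ) ≺ 𝒫 ℕ
  ⊎ℕ-small {X} (X↣𝒫 , ¬𝒫↣X) = mk↣ {to = tag} (λ {x} {y} → tag-inj x y) , large
    where
    module I = Injection X↣𝒫

    tag : X ⊎ ℕ → 𝒫 ℕ
    tag (inj₁ x) = couple full (I.to x)
    tag (inj₂ n) = couple ∅ ⟦ (_≡ n) ⟧

    full≢∅ : full ≢ ∅ {ℕ}
    full≢∅ p with () ← cong-app p 0

    tag-inj : ∀ x y → tag x ≡ tag y → x ≡ y
    tag-inj (inj₁ x) (inj₁ y) p = cong inj₁ (I.injective (proj₂ (couple-injective _ _ _ _ p)))
    tag-inj (inj₁ x) (inj₂ n) p = ⊥-elim (full≢∅ (proj₁ (couple-injective _ _ _ _ p)))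
    tag-inj (inj₂ n) (inj₁ x) p = ⊥-elim (full≢∅ (sym (proj₁ (couple-injective _ _ _ _ p))))
    tag-inj (inj₂ m) (inj₂ n) p = cong inj₂
      (⟦⟧⁻ {P = _≡ n} (subst (m ∈_) (proj₂ (couple-injective _ _ _ _ p)) (⟦⟧⁺ refl)))

    large : ¬ (𝒫 ℕ ↣ (X ⊎ ℕ))
    large ι with em {P = ∃[ A ] (∀ B → ∃[ x ] (Injection.to ι (couple A B) ≡ inj₁ x))}
    ... | yes (A , row) = ¬𝒫↣X (mk↣ {to = proj₁ ∘ row} λ {B} {C} p →
          proj₂ (couple-injective A B A C (Injection.injective ι
            (trans (proj₂ (row B)) (trans (cong inj₁ p) (sym (proj₂ (row C))))))))
    ... | no  none = cantor (mk↣ {to = λ A → proj₁ (proj₂ (meets A))} λ {A} {C} p →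
          proj₁ (couple-injective A _ C _ (Injection.injective ι
            (trans (proj₂ (proj₂ (meets A))) (trans (cong inj₂ p) (sym (proj₂ (proj₂ (meets C)))))))))
      where
      side : (s : X ⊎ ℕ) → ¬ (∃[ x ] (s ≡ inj₁ x)) → ∃[ n ] (s ≡ inj₂ n)
      side (inj₁ x) p = ⊥-elim (p (x , refl))
      side (inj₂ n) p = n , refl

      meets : ∀ A → ∃[ B ] ∃[ n ] (Injection.to ι (couple A B) ≡ inj₂ n)
      meets A = byContradiction λ ¬meets → none (A , λ B → byContradiction λ p →
        ¬meets (B , side _ p))

  -- A well-ordering of the continuum with small initial segments

  record IsWellOrder {K : Set} (seg : K → 𝒫 K) : Set where
    field
      wellFounded : WellFounded (λ y x → y ∈ seg x)
      transitive  : ∀ {x y z} → z ∈ seg y → y ∈ seg x → z ∈ seg x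
      total       : ∀ {x y} → x ≢ y → y ∈ seg x ⊎ x ∈ seg y

  module Zermelo (K : Set) (k₀ : K) where

    next : 𝒫 K → K
    next S with em {P = ∃[ x ] (¬ (x ∈ S))}
    ... | yes (x , _) = x
    ... | no  _       = k₀

    next∉ : ∀ {S x} → ¬ (x ∈ S) → ¬ (next S ∈ S)
    next∉ {S} x∉S with em {P = ∃[ x ] (¬ (x ∈ S))}
    ... | yes (_ , p) = p
    ... | no  none    = ⊥-elim (none (_ , x∉S))

    succ : 𝒫 K → 𝒫 K
    succ S = ⟦ (λ x → x ∈ S ⊎ x ≡ next S) ⟧

    -- The sets obtained from ∅ by adding chosen points, one at a time.
    -- They turn out to be the initial segments of a well-ordering.
    data Tower : 𝒫 K → Set₁ where
      grow  : ∀ {S} → Tower S → Tower (succ S)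
      union : (F : 𝒫 (𝒫 K)) → (∀ S → S ∈ F → Tower S) →
              Tower ⟦ (λ x → ∃[ S ] (S ∈ F × x ∈ S)) ⟧

    ⊆-succ : ∀ {S} → S ⊆ succ S
    ⊆-succ x x∈S = ⟦⟧⁺ (inj₁ x∈S)

    Comparable : 𝒫 K → Set₁
    Comparable S = ∀ {T} → Tower T → T ⊆ S ⊎ S ⊆ T

    -- Nothing lies strictly between T and succ T.
    dichotomy : ∀ {S T} → Comparable S → Tower T → T ⊆ S ⊎ succ S ⊆ T
    dichotomy {S} cmp (grow {T} t) with dichotomy cmp t
    ... | inj₂ S⁺⊆T = inj₂ λ x → ⊆-succ x ∘ S⁺⊆T x
    ... | inj₁ T⊆S with ∈? S (next T)
    ...   | inj₁ next∈S = inj₁ λ x x∈T⁺ →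
            [ T⊆S x , (λ { refl → next∈S }) ]′ (⟦⟧⁻ x∈T⁺)
    ...   | inj₂ next∉S with cmp (grow t)
    ...     | inj₁ T⁺⊆S = inj₁ T⁺⊆S
    ...     | inj₂ S⊆T⁺ = inj₂ (subst (λ R → succ R ⊆ succ T) T≡S λ x p → p)
      where
      T≡S : T ≡ S
      T≡S = 𝒫-≡ T⊆S λ x x∈S → [ id , (λ { refl → ⊥-elim (next∉S x∈S) }) ]′ (⟦⟧⁻ (S⊆T⁺ x x∈S))
    dichotomy {S} cmp (union F towers) with em {P = ∃[ T ] (T ∈ F × ¬ (T ⊆ S))}
    ... | no  all = inj₁ λ x p → let T , T∈F , x∈T = ⟦⟧⁻ p in
          byContradiction λ x∉S → all (T , T∈F , λ T⊆S → x∉S (T⊆S x x∈T))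
    ... | yes (T , T∈F , T⊈S) with dichotomy cmp (towers T T∈F)
    ...   | inj₁ T⊆S  = ⊥-elim (T⊈S T⊆S)
    ...   | inj₂ S⁺⊆T = inj₂ λ x p → ⟦⟧⁺ (T , T∈F , S⁺⊆T x p)

    comparable : ∀ {S} → Tower S → Comparable S
    comparable (grow s) t with dichotomy (comparable s) t
    ... | inj₁ T⊆S  = inj₁ λ x → ⊆-succ x ∘ T⊆S x
    ... | inj₂ S⁺⊆T = inj₂ S⁺⊆T
    comparable (union F towers) {T} t with em {P = ∃[ S ] (S ∈ F × T ⊆ S)}
    ... | yes (S , S∈F , T⊆S) = inj₁ λ x x∈T → ⟦⟧⁺ (S , S∈F , T⊆S x x∈T)
    ... | no  none = inj₂ λ x p → below x (⟦⟧⁻ p)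
      where
      below : ∀ x → ∃[ S ] (S ∈ F × x ∈ S) → x ∈ T
      below x (S , S∈F , x∈S) with comparable (towers S S∈F) t
      ... | inj₁ T⊆S = ⊥-elim (none (S , S∈F , T⊆S))
      ... | inj₂ S⊆T = S⊆T x x∈S

    avoiding : K → 𝒫 (𝒫 K)
    avoiding x = ⟦ (λ T → Tower T × ¬ (x ∈ T)) ⟧

    seg : K → 𝒫 K
    seg x = ⟦ (λ y → ∃[ T ] (T ∈ avoiding x × y ∈ T)) ⟧

    seg-tower : ∀ x → Tower (seg x)
    seg-tower x = union (avoiding x) λ T → proj₁ ∘ ⟦⟧⁻

    x∉seg : ∀ x → ¬ (x ∈ seg x)
    x∉seg x p with T , T-avoids , x∈T ← ⟦⟧⁻ p = proj₂ (⟦⟧⁻ T-avoids) x∈T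

    -- Otherwise succ (seg x) would be a larger tower avoiding x.
    x∈succ-seg : ∀ x → x ∈ succ (seg x)
    x∈succ-seg x = byContradiction λ x∉ → next∉ {seg x} (x∉seg x)
      (⟦⟧⁺ (succ (seg x) , ⟦⟧⁺ (grow (seg-tower x) , x∉) , ⟦⟧⁺ (inj₂ refl)))

    x≡next-seg : ∀ x → x ≡ next (seg x)
    x≡next-seg x = [ (λ p → ⊥-elim (x∉seg x p)) , id ]′ (⟦⟧⁻ (x∈succ-seg x))

    seg-⊆ : ∀ {T x} → Tower T → x ∈ T → seg x ⊆ T
    seg-⊆ {T} {x} t x∈T y p with ⟦⟧⁻ p
    ... | S , S-avoids , y∈S with comparable t (proj₁ (⟦⟧⁻ S-avoids))
    ...   | inj₁ S⊆T = S⊆T y y∈S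
    ...   | inj₂ T⊆S = ⊥-elim (proj₂ (⟦⟧⁻ S-avoids) (T⊆S x x∈T))

    accessible : ∀ {T} → Tower T → ∀ x → x ∈ T → Acc (λ y x → y ∈ seg x) x
    accessible (grow {S} s) x x∈S⁺ with ∈? S x | ⟦⟧⁻ x∈S⁺
    ... | inj₁ x∈S | _        = accessible s x x∈S
    ... | inj₂ x∉S | inj₁ x∈S = ⊥-elim (x∉S x∈S)
    ... | inj₂ x∉S | inj₂ refl = acc λ {y} y<x → accessible s y (below y y<x)
      where
      below : seg (next S) ⊆ S
      below y p with [ id , (λ { refl → ⊥-elim (x∉seg (next S) p) }) ]′
                       (⟦⟧⁻ (seg-⊆ (grow s) x∈S⁺ y p))
      ... | y∈S = y∈S
    accessible (union F towers) x p with S , S∈F , x∈S ← ⟦⟧⁻ p = accessible (towers S S∈F) x x∈S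

    wellOrder : IsWellOrder seg
    wellOrder = record
      { wellFounded = λ x → accessible (grow (seg-tower x)) x (x∈succ-seg x)
      ; transitive  = λ {x} {y} {z} z<y y<x → seg-⊆ (seg-tower x) y<x z z<y
      ; total       = λ {x} {y} x≢y →
          [ inj₁
          , (λ y≮x → inj₂ (⟦⟧⁺ (succ (seg x)
              , ⟦⟧⁺ (grow (seg-tower x) , λ y∈ →
                  [ y≮x , (λ y≡next → x≢y (trans (x≡next-seg x) (sym y≡next))) ]′ (⟦⟧⁻ y∈))
              , x∈succ-seg x))) ]′ (∈? (seg x) y)
      }

  Elem-↣ : (A : 𝒫 X) → Elem A ↣ X
  Elem-↣ A = mk↣ {to = proj₁} Elem-≡

  opaque
    -- If some segment of a given well-ordering is not small, the ordering is
    -- pulled back along an injection into the least such segment.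
    smallWellOrder : ∃[ seg ] (IsWellOrder {𝒫 ℕ} seg × ∀ A → Elem (seg A) ≺ 𝒫 ℕ)
    smallWellOrder with em {P = ∃[ A ] (𝒫 ℕ ↣ Elem (Zermelo.seg (𝒫 ℕ) ∅ A))}
    ... | no  none = seg , wellOrder , λ A → Elem-↣ (seg A) , λ ι → none (A , ι)
      where open Zermelo (𝒫 ℕ) ∅
    ... | yes (A₀ , ι₀) = seg′ , wellOrder′ , small
      where
      open Zermelo (𝒫 ℕ) ∅
      module O = IsWellOrder wellOrder

      least : ∀ A → 𝒫 ℕ ↣ Elem (seg A) →
        ∃[ B ] ((𝒫 ℕ ↣ Elem (seg B)) × ∀ C → C ∈ seg B → ¬ (𝒫 ℕ ↣ Elem (seg C)))
      least = All.wfRec O.wellFounded 0ℓ _ λ A IH ι →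
        [ (λ { (C , C<A , κ) → IH C<A κ })
        , (λ none → A , ι , λ C C<A κ → none (C , C<A , κ)) ]′ (toSum em)

      module ι = Injection (proj₁ (proj₂ (least A₀ ι₀)))

      j : 𝒫 ℕ → 𝒫 ℕ
      j = proj₁ ∘ ι.to

      j-inj : Injective _≡_ _≡_ j
      j-inj = ι.injective ∘ Elem-≡

      seg′ : 𝒫 ℕ → 𝒫 (𝒫 ℕ)
      seg′ A B = seg (j A) (j B)

      wellOrder′ : IsWellOrder seg′
      wellOrder′ = record
        { wellFounded = On.wellFounded j O.wellFounded
        ; transitive  = O.transitive
        ; total       = λ A≢B → O.total (A≢B ∘ j-inj)
        }

      small : ∀ A → Elem (seg′ A) ≺ 𝒫 ℕ
      small A = Elem-↣ (seg′ A) , λ κ →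
        proj₂ (proj₂ (least A₀ ι₀)) (j A) (proj₂ (ι.to A)) (mk↣
          {to = λ B → j (proj₁ (Injection.to κ B)) , proj₂ (Injection.to κ B)}
          λ p → Injection.injective κ (Elem-≡ (j-inj (cong proj₁ p))))

  -- A tower of positive sets and the Q-point it generates

  opaque
    -- An incorrect choice may occur at a stage where no correct one exists, so
    -- correctness of all choices is left to a separate induction.
    transfinite : {K V : Set} {seg : K → 𝒫 K} → V → WellFounded (λ y x → y ∈ seg x) →
      (R : ∀ x → (Elem (seg x) → V) → V → Set) →
      Σ[ B ∈ (K → V) ] (∀ x → ∃ (R x (B ∘ proj₁)) → R x (B ∘ proj₁) (B x))
    transfinite {K} {V} {seg} v₀ wf R = B , λ x ex →
      subst (R x (B ∘ proj₁)) (sym (FixPoint.unfold-wfRec wf (λ _ → V) f f-ext)) (choose-correct x _ ex)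
      where
      choose : ∀ x → (Elem (seg x) → V) → V
      choose x F with em {P = ∃ (R x F)}
      ... | yes (v , _) = v
      ... | no  _       = v₀

      choose-correct : ∀ x F → ∃ (R x F) → R x F (choose x F)
      choose-correct x F ex with em {P = ∃ (R x F)}
      ... | yes (_ , r) = r
      ... | no  ¬ex     = ⊥-elim (¬ex ex)

      f : ∀ x → (∀ {y} → y ∈ seg x → V) → V
      f x IH = choose x λ (y , y<x) → IH y<x

      f-ext : ∀ x {IH IH′ : ∀ {y} → y ∈ seg x → V} →
        (∀ {y} y<x → IH {y} y<x ≡ IH′ y<x) → f x IH ≡ f x IH′
      f-ext x eq = cong (choose x) (ext λ (y , y<x) → eq y<x)

      B : K → V
      B = All.wfRec wf 0ℓ (λ _ → V) f

  -- The property of J on which the construction rests: fewer than continuum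
  -- many sets with positive finite intersections have a positive
  -- pseudointersection modulo J.
  Extendible : Family ℕ → Set₁
  Extendible J = (X : Set) → X ≺ 𝒫 ℕ → (F : X → 𝒫 ℕ) →
    (∀ xs → (J ⁺) (⋂ (map F xs))) → ∃[ A ] ((J ⁺) A × ∀ x → J (A ∖ F x))

  module Construction {J : Family ℕ} (ideal : IsIdeal J) (hom : IsKBHomogeneous J)
    (EDFin≰J : ¬ (EDFin ≤KB J)) (extend : Extendible J) where
    open Ideal ideal
    open IsIdeal ideal using (finite; proper)

    seg = proj₁ smallWellOrder
    open IsWellOrder (proj₁ (proj₂ smallWellOrder))

    -- The index A codes a set, to be decided, and a partition, to be selected
    -- from; every such pair has an index.
    Good : ∀ A → (Elem (seg A) → 𝒫 ℕ) → 𝒫 ℕ → Set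
    Good A F B = (J ⁺) B × (∀ C → B ⊆ᴶ F C) ×
      (B ⊆ decode A 0 ⊎ B ⊆ ∁ (decode A 0)) × Selects B (decode A ∘ suc)

    choices = transfinite ∅ wellFounded Good
    B = proj₁ choices

    lower-bound : ∀ {A} → (∀ C → C ∈ seg A → Good C (B ∘ proj₁) (B C)) →
      ∀ C Cs → Σ[ D ∈ Elem (seg A) ] (B (proj₁ D) ⊆ᴶ ⋂ (map (B ∘ proj₁) (C ∷ Cs)))
    lower-bound good C [] = C , ⊆⇒⊆ᴶ λ x p → ∩⁺ (B (proj₁ C)) full p tt
    lower-bound good C@(c , c<A) (C′ ∷ Cs) with lower-bound good C′ Cs
    ... | D@(d , d<A) , D-below with em {P = c ≡ d}
    ...   | yes refl = D , ⊆ᴶ-∩ ⊆ᴶ-refl D-below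
    ...   | no  c≢d with total c≢d
    ...     | inj₁ d<c = C , ⊆ᴶ-∩ ⊆ᴶ-refl
                (⊆ᴶ-trans (proj₁ (proj₂ (good c c<A)) (d , d<c)) D-below)
    ...     | inj₂ c<d = D , ⊆ᴶ-∩ (proj₁ (proj₂ (good d d<A)) (c , c<d)) D-below

    centred : ∀ A → (∀ C → C ∈ seg A → Good C (B ∘ proj₁) (B C)) →
      ∀ Cs → (J ⁺) (⋂ (map (B ∘ proj₁) Cs))
    centred A IH []       = proper
    centred A IH (C ∷ Cs) with (d , d<A) , D-below ← lower-bound IH C Cs =
      positive-⊆ᴶ (proj₁ (IH d d<A)) D-below

    -- The goodness of the earlier sets makes their family centred, which is what
    -- finding the next set requires.
    good : ∀ A → Good A (B ∘ proj₁) (B A)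
    good = All.wfRec wellFounded 0ℓ _ λ A IH → proj₂ choices A (step A λ C → IH {C})
      where
      step : ∀ A → (∀ C → C ∈ seg A → Good C (B ∘ proj₁) (B C)) → ∃ (Good A (B ∘ proj₁))
      step A IH
        with P , P⁺ , P-below ← extend (Elem (seg A)) (proj₂ (proj₂ smallWellOrder) A) (B ∘ proj₁) (centred A IH)
        with S , S⊆P , S⁺ , S-dec , S-sel ← positive-refine hom EDFin≰J P P⁺ (decode A 0) (decode A ∘ suc)
        = S , S⁺ , (λ C → ⊆ᴶ-trans (⊆⇒⊆ᴶ S⊆P) (almost (P-below C))) , S-dec , S-sel

    directed : ∀ A C → ∃[ D ] (B D ⊆ᴶ B A × B D ⊆ᴶ B C)
    directed A C with em {P = A ≡ C}
    ... | yes refl = A , ⊆ᴶ-refl , ⊆ᴶ-refl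
    ... | no  A≢C with total A≢C
    ...   | inj₁ C<A = A , ⊆ᴶ-refl , proj₁ (proj₂ (good A)) (C , C<A)
    ...   | inj₂ A<C = C , proj₁ (proj₂ (good C)) (A , A<C) , ⊆ᴶ-refl

    U : Family ℕ
    U A = ∃[ C ] (B C ⊆ᴶ A)

    task : 𝒫 ℕ → (ℕ → 𝒫 ℕ) → 𝒫 ℕ
    task A P = encode λ { zero → A ; (suc n) → P n }

    ultrafilter : IsUltrafilter U
    ultrafilter = record
      -- The index ∅ is arbitrary.
      { cofinite = λ A fin → ∅ , almost (null-⊆ (finite (∁ A) fin) λ x p → proj₂ (∩⁻ (B ∅) (∁ A) p))
      ; ∩-closed = λ { A A′ (C , CA) (C′ , C′A′) →
          let D , DC , DC′ = directed C C′ in D , ⊆ᴶ-∩ (⊆ᴶ-trans DC CA) (⊆ᴶ-trans DC′ C′A′) }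
      ; ⊆-closed = λ { A A′ A⊆A′ (C , CA) → C , ⊆ᴶ-trans CA (⊆⇒⊆ᴶ A⊆A′) }
      ; proper   = λ { (C , C∅) → proj₁ (good C) (null-⊆ (remainder C∅) λ x p → ∖⁺ (B C) ∅ p λ ()) }
      ; ultra    = λ A → let C = task A λ _ → ∅ in
          [ (λ p → inj₁ (C , ⊆⇒⊆ᴶ (subst (B C ⊆_) (decode-encode _ 0) p)))
          , (λ p → inj₂ (C , ⊆⇒⊆ᴶ (subst (λ A → B C ⊆ ∁ A) (decode-encode _ 0) p))) ]′
          (proj₁ (proj₂ (proj₂ (good C))))
      }

    dual-contains : ∀ {A} → J A → (U ⋆) A
    dual-contains {A} JA = Ultrafilter.dual⁺ ultrafilter
      (∅ , almost (null-⊆ JA λ x p → byContradiction λ x∉A →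
        proj₂ (∖⁻ (B ∅) (∁ A) p) (not⁺ (A x) x∉A)))

    -- B C meets every part at most once; a point is added in each missed part.
    selector : ∀ P → IsFinitePartition P → ∃[ S ] (U S × ∀ n → ∃! _≡_ (_∈ (S ∩ P n)))
    selector P part = S , (C , ⊆⇒⊆ᴶ λ x → ⟦⟧⁺ ∘ inj₁) , once
      where
      open IsFinitePartition part using (nonempty; disjoint)

      C = task ∅ P

      sel : Selects (B C) P
      sel = subst (Selects (B C)) (ext λ n → decode-encode _ (suc n))
                  (proj₂ (proj₂ (proj₂ (good C))))

      Missed : ℕ → Set
      Missed n = ∀ k → k ∈ B C → ¬ (k ∈ P n)

      S : 𝒫 ℕ
      S = ⟦ (λ k → k ∈ B C ⊎ (∃[ n ] (Missed n × k ≡ proj₁ (nonempty n)))) ⟧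

      same-part : ∀ {m n k} → k ∈ P m → k ∈ P n → m ≡ n
      same-part {m} {n} p q = byContradiction λ m≢n → disjoint m n m≢n _ p q

      once : ∀ n → ∃! _≡_ (_∈ (S ∩ P n))
      once n with em {P = ∃[ k ] (k ∈ B C × k ∈ P n)}
      ... | yes (k , k∈BC , k∈Pn) = k , ∩⁺ S (P n) (⟦⟧⁺ (inj₁ k∈BC)) k∈Pn , unique
        where
        unique : ∀ {l} → l ∈ S ∩ P n → k ≡ l
        unique {l} p with ∩⁻ S (P n) p
        ... | l∈S , l∈Pn with ⟦⟧⁻ l∈S
        ...   | inj₁ l∈BC = sel part n k l k∈BC l∈BC k∈Pn l∈Pn
        ...   | inj₂ (m , missed , refl) with refl ← same-part l∈Pn (proj₂ (nonempty m)) =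
                ⊥-elim (missed k k∈BC k∈Pn)
      ... | no none = proj₁ (nonempty n) ,
          ∩⁺ S (P n) (⟦⟧⁺ (inj₂ (n , (λ k p q → none (k , p , q)) , refl))) (proj₂ (nonempty n)) , unique
        where
        unique : ∀ {l} → l ∈ S ∩ P n → proj₁ (nonempty n) ≡ l
        unique {l} p with ∩⁻ S (P n) p
        ... | l∈S , l∈Pn with ⟦⟧⁻ l∈S
        ...   | inj₁ l∈BC = ⊥-elim (none (l , l∈BC , l∈Pn))
        ...   | inj₂ (m , missed , refl) with refl ← same-part l∈Pn (proj₂ (nonempty m)) = refl

    qpoint : IsQPoint U
    qpoint = record { isUltrafilter = ultrafilter ; selector = selector }

  equivalence : ∀ {J} → IsIdeal J → IsKBHomogeneous J → Extendible J → ConditionsEquivalent J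
  equivalence {J} ideal hom extend =
    mk⇔ a⇒b (c⇒a ∘ b⇒c) , mk⇔ b⇒c c⇒b
    where
    a⇒b : ConditionA J → ConditionB J
    a⇒b EDFin≰J = C.U , C.qpoint , λ J≰P → J≰P (id , id , λ B → C.dual-contains {B})
      where module C = Construction ideal hom EDFin≰J extend

    b⇒c : ConditionB J → ConditionC J
    b⇒c (U , qpoint , ¬point) = U , qpoint , λ weak → ¬point (weak ∘ ≤P⇒≤KB {I = J} {K = U ⋆})

    c⇒b : ConditionC J → ConditionB J
    c⇒b (U , qpoint , ¬weak) = U , qpoint , λ point → ¬weak (point ∘ QPoint-≤KB⇒≤P qpoint)

    c⇒a : ConditionC J → ConditionA J
    c⇒a (U , qpoint , ¬weak) EDFin≤J = ¬weak λ J≤U → QPoint⇒EDFin≰KB qpoint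
      (≤KB-trans {J = J} {K = U ⋆} EDFin≤J J≤U)

  -- Countable families: the case of CH

  -- CH applies to X ⊎ ℕ, which is infinite whatever X is.  The enumeration that
  -- it provides arranges the intersections of finitely many sets into a
  -- decreasing sequence.
  CH⇒extendible : ∀ {J} → IsIdeal J → IsP⁺ J → CH → Extendible J
  CH⇒extendible {J} ideal P⁺ ch X X-small F centred with em {P = (X ⊎ ℕ) ↣ ℕ}
  ... | no  uncountable = ⊥-elim (ch ((X ⊎ ℕ) ,
          (mk↣ {to = inj₂} (λ { refl → refl }) , uncountable) , ⊎ℕ-small X-small))
  ... | yes ι = result
    where
    index : X → ℕ
    index = Injection.to ι ∘ inj₁

    index-injective : ∀ {x y} → index x ≡ index y → x ≡ y
    index-injective p with refl ← Injection.injective ι p = refl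

    indexed : ℕ → List X
    indexed n with em {P = ∃[ x ] (index x ≡ n)}
    ... | yes (x , _) = [ x ]
    ... | no  _       = []

    ∈-indexed : ∀ x → x ∈ˡ indexed (index x)
    ∈-indexed x with em {P = ∃[ y ] (index y ≡ index x)}
    ... | yes (y , p) = here (index-injective (sym p))
    ... | no  none    = ⊥-elim (none (x , refl))

    indexed< : ℕ → List X
    indexed< zero    = []
    indexed< (suc n) = indexed n ++ indexed< n

    ⋂-++ : ∀ xs ys → ⋂ (map F (xs ++ ys)) ⊆ ⋂ (map F ys)
    ⋂-++ []       ys n p = p
    ⋂-++ (x ∷ xs) ys n p = ⋂-++ xs ys n (proj₂ (∩⁻ (F x) (⋂ (map F (xs ++ ys))) p))

    result : ∃[ A ] ((J ⁺) A × ∀ x → J (A ∖ F x))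
    result
      with A , A⁺ , A-below ← P⁺ (λ n → ⋂ (map F (indexed< n))) (centred ∘ indexed<)
                                  (λ n → ⋂-++ (indexed n) (indexed< n))
      = A , A⁺ , λ x → IsIdeal.⊆-closed ideal _ _
          (λ n p → let n∈A , n∉Fx = ∖⁻ A (F x) p in
            ∖⁺ A (⋂ (map F (indexed< (suc (index x))))) n∈A λ q →
              n∉Fx (⋂⁻ (map F (indexed< (suc (index x)))) q (∈-map⁺ F (∈-++⁺ˡ (∈-indexed x)))))
          (A-below (suc (index x)))

  -- Families of size less than 𝔭: the case of an F-sigma ideal

  -- König's lemma in the Cantor space, for members of C that include finite
  -- subsets of A.  The stages fix one more coordinate at a time, keeping every
  -- finite subset of A inside some member of C that agrees with the fixed
  -- coordinates.
  closed-compact : (C : Family ℕ) → IsClosed C → (A : 𝒫 ℕ) →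
    (∀ s → All (_∈ A) s → ∃[ D ] (C D × All (_∈ D) s)) → ∃[ D ] (C D × A ⊆ D)
  closed-compact C closed A finitely = limit , limit∈C , A⊆limit
    where
    Extends : ℕ → 𝒫 ℕ → Set
    Extends n E = ∀ s → All (_∈ A) s →
      ∃[ D ] (C D × All (_∈ D) s × ∀ i → i < n → D i ≡ E i)

    fix : ℕ → Bool → 𝒫 ℕ → 𝒫 ℕ
    fix n b E i with i ≟ n
    ... | yes _ = b
    ... | no  _ = E i

    fix-≡ : ∀ n b E → fix n b E n ≡ b
    fix-≡ n b E with n ≟ n
    ... | yes _  = refl
    ... | no n≢n = ⊥-elim (n≢n refl)

    fix-< : ∀ n b E i → i < n → fix n b E i ≡ E i
    fix-< n b E i i<n with i ≟ n
    ... | yes refl = ⊥-elim (n≮n n i<n)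
    ... | no  _    = refl

    -- If both values of the new coordinate failed, on s true and s false, then
    -- E would fail on their union.
    extend-one : ∀ n E → Extends n E → ∃[ b ] Extends (suc n) (fix n b E)
    extend-one n E E-ext = byContradiction λ none →
      let failure : ∀ b → ∃[ s ] (All (_∈ A) s × ¬ (∃[ D ] (C D × All (_∈ D) s ×
                      ∀ i → i < suc n → D i ≡ fix n b E i)))
          failure b = byContradiction λ ¬fails → none (b , λ s s⊆A →
            byContradiction λ ¬D → ¬fails (s , s⊆A , ¬D))
          s = proj₁ ∘ failure
          D , D∈C , s⊆D , D≡E = E-ext (s true ++ s false)
            (All.++⁺ (proj₁ (proj₂ (failure true))) (proj₁ (proj₂ (failure false))))
          part : ∀ b → All (_∈ D) (s b)
          part = λ { true → All.++⁻ˡ (s true) s⊆D ; false → All.++⁻ʳ (s true) s⊆D }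
          agree : ∀ i → i < suc n → D i ≡ fix n (D n) E i
          agree i i<1+n = [ (λ i<n → trans (D≡E i i<n) (sym (fix-< n (D n) E i i<n)))
                          , (λ { refl → sym (fix-≡ n (D n) E) }) ]′ (m≤n⇒m<n∨m≡n (≤-pred i<1+n))
      in proj₂ (proj₂ (failure (D n))) (D , D∈C , part (D n) , agree)

    stage : ∀ n → Σ (𝒫 ℕ) (Extends n)
    stage zero    = ∅ , λ s s⊆A → let D , D∈C , s⊆D = finitely s s⊆A in D , D∈C , s⊆D , λ _ ()
    stage (suc n) = let E , E-ext = stage n ; b , E′-ext = extend-one n E E-ext in
      fix n b E , E′-ext

    limit : 𝒫 ℕ
    limit i = proj₁ (stage (suc i)) i

    stage≡limit : ∀ n i → i < n → proj₁ (stage n) i ≡ limit i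
    stage≡limit (suc n) i i<1+n =
      [ (λ i<n → trans (fix-< n _ _ i i<n) (stage≡limit n i i<n)) , (λ { refl → refl }) ]′
      (m≤n⇒m<n∨m≡n (≤-pred i<1+n))

    approximate : ∀ n → Extends n limit
    approximate n s s⊆A = let D , D∈C , s⊆D , D≡ = proj₂ (stage n) s s⊆A in
      D , D∈C , s⊆D , λ i i<n → trans (D≡ i i<n) (stage≡limit n i i<n)

    limit∈C : C limit
    limit∈C = byContradiction λ limit∉C →
      let n , outside = closed limit limit∉C
          D , D∈C , _ , D≡limit = approximate n [] []
      in outside D D≡limit D∈C

    A⊆limit : A ⊆ limit
    A⊆limit a a∈A =
      let D , _ , a∈D , D≡limit = approximate (suc a) [ a ] (a∈A ∷ []) in
      subst T (D≡limit a ≤-refl) (All.head a∈D)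

  image : (X → 𝒫 ℕ) → 𝒫 (𝒫 ℕ)
  image G = ⟦ (λ B → ∃[ x ] (G x ≡ B)) ⟧

  opaque
    -- A family indexed by a small type has fewer than 𝔭 members.
    𝔭≡𝔠⇒pseudointersection : 𝔭≡𝔠 → X ≺ 𝒫 ℕ → (G : X → 𝒫 ℕ) → SFIP (image G) →
      ∃[ Q ] (Infinite (_∈ Q) × ∀ x → Finite (_∈ Q ∖ G x))
    𝔭≡𝔠⇒pseudointersection {X} 𝔭≡𝔠 X-small G sfip =
      let Q , Q-infinite , Q-below = pseudointersection in
      Q , Q-infinite , λ x → Q-below (G x) (⟦⟧⁺ (x , refl))
      where
      pseudointersection : HasPseudointersection (image G)
      pseudointersection = byContradiction λ none →
        let module κ = Injection (IsPseudointersectionNumber.least 𝔭≡𝔠 (image G) sfip none)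
            preimage : ∀ B → ∃[ x ] (G x ≡ proj₁ (κ.to B))
            preimage B = ⟦⟧⁻ (proj₂ (κ.to B))
        in proj₂ X-small (mk↣ {to = proj₁ ∘ preimage} λ {B} {D} p →
          κ.injective (Elem-≡ (trans (sym (proj₂ (preimage B)))
                              (trans (cong G p) (proj₂ (preimage D))))))

  Fσ⇒extendible : ∀ {J} → IsIdeal J → IsFσ J → 𝔭≡𝔠 → Extendible J
  Fσ⇒extendible {J} ideal (C , C-closed , J⇔C) 𝔭≡𝔠 X X-small F centred =
    A , A⁺ , λ x → finite (A ∖ F x) (A∖F-finite x)
    where
    open IsIdeal ideal

    Large : ℕ → List ℕ → Set
    Large n s = ∀ i → i < n → ∀ D → C i D → ¬ All (_∈ D) s

    -- If every finite subset of A were included in a member of C n, then by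
    -- compactness A would be included in one, hence null.
    escape : ∀ {A} → (J ⁺) A → ∀ n → ∃[ s ] (All (_∈ A) s × ∀ D → C n D → ¬ All (_∈ D) s)
    escape {A} A⁺ n = byContradiction λ none →
      let D , D∈C , A⊆D = closed-compact (C n) (C-closed n) A λ s s⊆A → byContradiction λ ¬D →
            none (s , s⊆A , λ D D∈C s⊆D → ¬D (D , D∈C , s⊆D))
      in A⁺ (⊆-closed A D A⊆D (Equivalence.from (J⇔C D) (n , D∈C)))

    large-subset : ∀ {A} → (J ⁺) A → ∀ n → ∃[ s ] (All (_∈ A) s × Large n s)
    large-subset A⁺ zero    = [] , [] , λ _ ()
    large-subset A⁺ (suc n) =
      let s , s⊆A , s-large = large-subset A⁺ n
          t , t⊆A , t-large = escape A⁺ n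
      in t ++ s , All.++⁺ t⊆A s⊆A , λ i i<1+n D D∈C t++s⊆D →
          [ (λ i<n → s-large i i<n D D∈C (All.++⁻ʳ t t++s⊆D))
          , (λ { refl → t-large D D∈C (All.++⁻ˡ t t++s⊆D) }) ]′ (m≤n⇒m<n∨m≡n (≤-pred i<1+n))

    -- The codes stand for a number n with a finite set s.  In a
    -- pseudointersection of all these sets, the sets of the first kind put almost
    -- every s inside F x, and those of the second kind make n grow beyond bounds
    -- and s escape from C 0, ..., C (n - 1).
    G : X ⊎ ℕ → 𝒫 ℕ
    G (inj₁ x) = ⟦ (λ c → ∃[ n ] ∃[ s ] (code (n ∷ s) ≡ c × All (_∈ F x) s)) ⟧
    G (inj₂ k) = ⟦ (λ c → ∃[ n ] ∃[ s ] (code (n ∷ s) ≡ c × k ≤ n × Large n s)) ⟧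

    requirements : ∀ Bs → All (_∈ image G) Bs → ∃[ xs ] ∃[ k ] (∀ n s → k ≤ n → Large n s →
      All (_∈ ⋂ (map F xs)) s → code (n ∷ s) ∈ ⋂ Bs)
    requirements []       []            = [] , 0 , λ _ _ _ _ _ → tt
    requirements (B ∷ Bs) (B∈S ∷ Bs⊆S) with requirements Bs Bs⊆S | ⟦⟧⁻ B∈S
    ... | xs , k , req | inj₁ x , refl = x ∷ xs , k , λ n s k≤n s-large s⊆ →
          ∩⁺ (G (inj₁ x)) (⋂ Bs)
            (⟦⟧⁺ (n , s , refl , All.map (λ p → proj₁ (∩⁻ (F x) (⋂ (map F xs)) p)) s⊆))
            (req n s k≤n s-large (All.map (λ p → proj₂ (∩⁻ (F x) (⋂ (map F xs)) p)) s⊆))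
    ... | xs , k , req | inj₂ l , refl = xs , k ⊔ l , λ n s k⊔l≤n s-large s⊆ →
          ∩⁺ (G (inj₂ l)) (⋂ Bs)
            (⟦⟧⁺ (n , s , refl , m⊔n≤o⇒n≤o k l k⊔l≤n , s-large))
            (req n s (m⊔n≤o⇒m≤o k l k⊔l≤n) s-large s⊆)

    sfip : SFIP (image G)
    sfip Bs Bs⊆S with xs , k , req ← requirements Bs Bs⊆S = unbounded⇒infinite λ m →
      let s , s⊆ , s-large = large-subset (centred xs) (m ⊔ k) in
      code (m ⊔ k ∷ s) , ≤-trans (s≤s (m≤m⊔n m k)) (<pairˡ (m ⊔ k) (code s)) ,
      req (m ⊔ k) s (m≤n⊔m m k) s-large s⊆

    pseudointersection = 𝔭≡𝔠⇒pseudointersection 𝔭≡𝔠 (⊎ℕ-small X-small) G sfip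

    Q = proj₁ pseudointersection

    Q∖G-finite : ∀ z → Finite (_∈ Q ∖ G z)
    Q∖G-finite = proj₂ (proj₂ pseudointersection)

    A : 𝒫 ℕ
    A = ⟦ (λ a → ∃[ n ] ∃[ s ] (code (n ∷ s) ∈ Q × a ∈ˡ s)) ⟧

    uncode : ℕ → List ℕ
    uncode c with em {P = ∃[ s ] (code s ≡ c)}
    ... | yes (s , _) = s
    ... | no  _       = []

    uncode-code : ∀ s → uncode (code s) ≡ s
    uncode-code s with em {P = ∃[ t ] (code t ≡ code s)}
    ... | yes (t , p) = code-injective t s p
    ... | no  none    = ⊥-elim (none (s , refl))

    A∖F-finite : ∀ x → Finite (_∈ A ∖ F x)
    A∖F-finite x = concat (map uncode cs) , λ a p →
      covered (proj₂ (∖⁻ A (F x) p)) (⟦⟧⁻ (proj₁ (∖⁻ A (F x) p)))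
      where
      cs = proj₁ (Q∖G-finite (inj₁ x))

      ∉G : ∀ {a n s} → ¬ (a ∈ F x) → a ∈ˡ s → ¬ (code (n ∷ s) ∈ G (inj₁ x))
      ∉G {a} {n} {s} a∉F a∈s q = clash (⟦⟧⁻ q)
        where
        clash : ¬ (∃[ n′ ] ∃[ s′ ] (code (n′ ∷ s′) ≡ code (n ∷ s) × All (_∈ F x) s′))
        clash (n′ , s′ , eq , s′⊆F) with refl ← code-injective (n′ ∷ s′) (n ∷ s) eq =
          a∉F (All.lookup s′⊆F a∈s)

      covered : ∀ {a} → ¬ (a ∈ F x) → ∃[ n ] ∃[ s ] (code (n ∷ s) ∈ Q × a ∈ˡ s) →
        a ∈ˡ concat (map uncode cs)
      covered {a} a∉F (n , s , c∈Q , a∈s) = ∈-concat⁺′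
        (subst (a ∈ˡ_) (sym (uncode-code (n ∷ s))) (there a∈s))
        (∈-map⁺ uncode (proj₂ (Q∖G-finite (inj₁ x)) (code (n ∷ s))
          (∖⁺ Q (G (inj₁ x)) c∈Q (∉G {n = n} a∉F a∈s))))

    Q-meets-G : ∀ z → ∃[ c ] (c ∈ Q × c ∈ G z)
    Q-meets-G z = byContradiction λ none → proj₁ (proj₂ pseudointersection)
      (proj₁ (Q∖G-finite z) , λ c c∈Q → proj₂ (Q∖G-finite z) c
        (∖⁺ Q (G z) c∈Q λ c∈G → none (c , c∈Q , c∈G)))

    A∉C : ∀ m → ¬ C m A
    A∉C m A∈C = let c , c∈Q , c∈G = Q-meets-G (inj₂ (suc m)) in clash c∈Q (⟦⟧⁻ c∈G)
      where
      clash : ∀ {c} → c ∈ Q → ¬ (∃[ n ] ∃[ s ] (code (n ∷ s) ≡ c × suc m ≤ n × Large n s))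
      clash c∈Q (n , s , refl , m<n , s-large) =
        s-large m m<n A A∈C (All.tabulate λ a∈s → ⟦⟧⁺ (n , s , c∈Q , a∈s))

    A⁺ : (J ⁺) A
    A⁺ JA = let m , A∈C = Equivalence.to (J⇔C A) JA in A∉C m A∈C

theorem8p5 : (∀ {ℓ} → ExcludedMiddle ℓ) → (∀ {a b} → Extensionality a b) →
    (J : Family ℕ) → IsIdeal J → IsP⁺ J → IsKBHomogeneous J →
    (CH → ConditionsEquivalent J) × (IsFσ J → 𝔭≡𝔠 → ConditionsEquivalent J)
theorem8p5 em ext J ideal P⁺ hom =
  (λ ch → equivalence em ext ideal hom (CH⇒extendible em ext ideal P⁺ ch)) ,
  (λ Fσ 𝔭≡𝔠 → equivalence em ext ideal hom (Fσ⇒extendible em ext ideal Fσ 𝔭≡𝔠))
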